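{- Any $\varepsilon$-edge-differentially private algorithm to compute the weight of a minimum spanning tree in an incremental graph sequence of length $T$ must have additive error $\Omega(W\log T)$ when the edge weights are in $\{1,\dots,W\}$ and $W$ is a publicly known parameter. This holds even with $\varepsilon=1$.
   Context: Graphs are undirected and edge-weighted. An incremental graph sequence $(G_1,\dots,G_T)$ arises from an initial (possibly non-empty) graph $G_0$ by inserting at each time $t$ a set $\partial V_t^+$ of nodes and a set $\partial E_t^+$ of edges (no deletions). Two incremental sequences are edge-adjacent (event-level) if they have the same length, initial graph and node insertions, and (up to exchanging them) there are an edge $e^*$ and a time $t^*$ with $\partial E_t^+=\partial E_t'^+$ for $t\ne t^*$, $\partial E_{t^*}'^+\subseteq\partial E_{t^*}^+$ and $\partial E_{t^*}^+\setminus\partial E_{t^*}'^+=\{e^*\}$. The algorithm is randomized and outputs a real number after each time step, an estimate of the value for the current graph. It is $\varepsilon$-edge-differentially private if $\Pr[\mathcal A(\mathcal G)\in S]\le e^\varepsilon\Pr[\mathcal A(\mathcal G')\in S]$ for all edge-adjacent $\mathcal G,\mathcal G'$ and all sets $S$ of possible output sequences. The additive error at a time step is the absolute difference between the output and the true value. For disconnected graphs, the weight of a minimum spanning tree means that of a minimum spanning forest. -}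

module Defs where

open import Level using (0ℓ) renaming (suc to lsuc)
open import Algebra.Bundles using (CommutativeRing)
open import Algebra.Structures using (IsCommutativeRing)
import Algebra.Properties.Monoid.Sum as MonoidSum
import Algebra.Properties.Monoid.Mult as MonoidMult
import Algebra.Properties.Semiring.Exp as SemiringExp
open import Data.Fin using (Fin; toℕ)
open import Data.List using (List; []; _∷_; _++_; map; sum; foldl; take; [_])
open import Data.List.Membership.Propositional using (_∈_; _∉_)
open import Data.List.Relation.Binary.BagAndSetEquality using (_∼[_]_; set)
open import Data.List.Relation.Binary.Subset.Propositional using (_⊆_)
open import Data.List.Relation.Unary.All using (All)
open import Data.List.Relation.Unary.AllPairs using (AllPairs)
open import Data.List.Relation.Unary.Linked using (Linked)
open import Data.List.Relation.Unary.Unique.Propositional using (Unique)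
open import Data.Nat as ℕ using (ℕ; suc)
open import Data.Nat.Base using (_!)
open import Data.Product using (Σ-syntax; ∃; ∃-syntax; _×_; _,_)
open import Data.Sum using (_⊎_)
open import Data.Vec as Vec using (Vec; lookup; tabulate; toList)
open import Function.Bundles using (_⇔_)
open import Relation.Binary.Construct.Closure.ReflexiveTransitive using (Star)
open import Relation.Binary.Core using (Rel)
open import Relation.Binary.PropositionalEquality using (_≡_; _≢_)
open import Relation.Binary.Structures using (IsStrictTotalOrder)
open import Relation.Nullary using (¬_; yes; no)
open import Relation.Unary using (Pred; Satisfiable; U; ∁; ⋃; _≐_; _⊥_)

------------------------------------------------------------------------
-- Edge-weighted graphs

-- Vertices are natural numbers.  Storing the endpoints in increasing order
-- makes edges undirected and excludes loops.  The bounds are irrelevant, so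
-- edges with the same endpoints and the same weight are equal.

record Edge (W : ℕ) : Set where
  field
    lo hi   : ℕ
    weight  : ℕ
    .lo<hi  : lo ℕ.< hi
    .1≤weight : 1 ℕ.≤ weight
    .weight≤W : weight ℕ.≤ W

  ends : ℕ × ℕ
  ends = lo , hi

open Edge public using (lo; hi; weight; ends)

-- Lists serve as finite sets: vertex and edge lists of well-formed graphs
-- have no repetitions, and adjacency of sequences is up to set equality.  An
-- algorithm may look at the order, which only enlarges the class considered.

record Graph (W : ℕ) : Set where
  constructor graph
  field
    V : List ℕ
    E : List (Edge W)

-- The last component says that the graph is simple: at most one edge (hence
-- one weight) for each pair of endpoints.

WellFormed : ∀ {W} → Graph W → Set
WellFormed (graph V E) =
    Unique V
  × All (λ e → lo e ∈ V × hi e ∈ V) E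
  × AllPairs (λ e f → ends e ≢ ends f) E

module _ {W : ℕ} where

  Adj : List (Edge W) → Rel ℕ 0ℓ
  Adj F u v = ∃[ e ] e ∈ F × (ends e ≡ (u , v) ⊎ ends e ≡ (v , u))

  Connected : List (Edge W) → Rel ℕ 0ℓ
  Connected F = Star (Adj F)

  Acyclic : List (Edge W) → Set
  Acyclic F = ∀ u v w vs → Unique (u ∷ v ∷ w ∷ vs) →
              ¬ Linked (Adj F) ((u ∷ v ∷ w ∷ vs) ++ [ u ])

  -- A spanning tree of every connected component.

  IsSpanningForest : Graph W → List (Edge W) → Set
  IsSpanningForest (graph V E) F =
      Unique F
    × F ⊆ E
    × Acyclic F
    × (∀ u v → Connected E u v → Connected F u v)

  totalWeight : List (Edge W) → ℕ
  totalWeight F = sum (map weight F)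

  IsMSFWeight : Graph W → ℕ → Set
  IsMSFWeight G w =
      (∃[ F ] IsSpanningForest G F × totalWeight F ≡ w)
    × (∀ F → IsSpanningForest G F → w ℕ.≤ totalWeight F)

------------------------------------------------------------------------
-- Incremental graph sequences

record Insertion (W : ℕ) : Set where
  field
    ∂V : List ℕ
    ∂E : List (Edge W)

open Insertion public

insert : ∀ {W} → Graph W → Insertion W → Graph W
insert (graph V E) u = graph (V ++ ∂V u) (E ++ ∂E u)

-- What has been received so far: the initial graph and the insertions.

History : ℕ → Set
History W = Graph W × List (Insertion W)

currentGraph : ∀ {W} → History W → Graph W
currentGraph (G₀ , us) = foldl insert G₀ us

-- The time steps 1, …, T are represented by the elements of Fin T.

historyAt : ∀ {W T} → Graph W → Vec (Insertion W) T → Fin T → History W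
historyAt G₀ us t = G₀ , take (suc (toℕ t)) (toList us)

-- Well-formedness of the graph at each time makes the inserted vertices and
-- edges new, and the inserted edges join vertices already present.

record IncrementalSequence (W T : ℕ) : Set where
  field
    G₀         : Graph W
    insertions : Vec (Insertion W) T

  prefix : Fin T → History W
  prefix = historyAt G₀ insertions

  graphAt : Fin T → Graph W
  graphAt t = currentGraph (prefix t)

  field
    wellFormed₀ : WellFormed G₀
    wellFormed  : ∀ t → WellFormed (graphAt t)

  ∂Vₜ : Fin T → List ℕ
  ∂Vₜ t = ∂V (lookup insertions t)

  ∂Eₜ : Fin T → List (Edge W)
  ∂Eₜ t = ∂E (lookup insertions t)

open IncrementalSequence public

-- s' is s without the insertion of a single edge e* at a single time t*.

OneEdgeLess : ∀ {W T} → Rel (IncrementalSequence W T) 0ℓ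
OneEdgeLess {W} {T} s s' =
    Graph.V (G₀ s) ∼[ set ] Graph.V (G₀ s')
  × Graph.E (G₀ s) ∼[ set ] Graph.E (G₀ s')
  × (∀ t → ∂Vₜ s t ∼[ set ] ∂Vₜ s' t)
  × Σ[ e* ∈ Edge W ] Σ[ t* ∈ Fin T ]
      (∀ t → t ≢ t* → ∂Eₜ s t ∼[ set ] ∂Eₜ s' t)
    × ∂Eₜ s' t* ⊆ ∂Eₜ s t*
    × (∀ e → (e ∈ ∂Eₜ s t* × e ∉ ∂Eₜ s' t*) ⇔ e ≡ e*)

EdgeAdjacent : ∀ {W T} → Rel (IncrementalSequence W T) 0ℓ
EdgeAdjacent s s' = OneEdgeLess s s' ⊎ OneEdgeLess s' s

------------------------------------------------------------------------
-- The real numbers, as a complete ordered field (classically unique up to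
-- isomorphism)

record CompleteOrderedField : Set₁ where
  infix  4 _≈_ _<_ _≤_
  infixl 6 _+_
  infixl 7 _*_
  infix  8 -_
  infix  9 _⁻¹
  field
    Carrier           : Set
    _≈_ _<_           : Rel Carrier 0ℓ
    _+_ _*_           : Carrier → Carrier → Carrier
    -_                : Carrier → Carrier
    0# 1#             : Carrier
    isCommutativeRing : IsCommutativeRing _≈_ _+_ _*_ -_ 0# 1#

    -- Total, as a convention; nothing is assumed about 0# ⁻¹.
    _⁻¹               : Carrier → Carrier
    ⁻¹-inverseʳ       : ∀ x → ¬ x ≈ 0# → x * x ⁻¹ ≈ 1#

    isStrictTotalOrder : IsStrictTotalOrder _≈_ _<_
    0<1                : 0# < 1#
    +-monoˡ-<          : ∀ z {x y} → x < y → x + z < y + z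
    *-pos              : ∀ {x y} → 0# < x → 0# < y → 0# < x * y

  _≤_ : Rel Carrier 0ℓ
  x ≤ y = ¬ (y < x)

  UpperBound : Pred Carrier 0ℓ → Pred Carrier 0ℓ
  UpperBound S b = ∀ x → S x → x ≤ b

  field
    complete : (S : Pred Carrier 0ℓ) → Satisfiable S → Satisfiable (UpperBound S) →
               ∃[ b ] UpperBound S b × (∀ b' → UpperBound S b' → b ≤ b')

  commutativeRing : CommutativeRing 0ℓ 0ℓ
  commutativeRing = record { isCommutativeRing = isCommutativeRing }

  open CommutativeRing commutativeRing public using (_-_; semiring; +-monoid)
  open IsStrictTotalOrder isStrictTotalOrder public using (_<?_)
  open MonoidSum +-monoid public using (sum-syntax)
  open MonoidMult +-monoid public using () renaming (_×_ to _·_)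
  open SemiringExp semiring public using (_^_)

  fromℕ : ℕ → Carrier
  fromℕ n = n · 1#

  ∣_∣ : Carrier → Carrier
  ∣ x ∣ with x <? 0#
  ... | yes _ = - x
  ... | no  _ = x

  _⟶_ : (ℕ → Carrier) → Carrier → Set
  a ⟶ l = ∀ δ → 0# < δ → ∃[ N ] (∀ n → N ℕ.≤ n → ∣ a n - l ∣ < δ)

  infix 5 ∑∞_≈_
  ∑∞_≈_ : (ℕ → Carrier) → Carrier → Set
  ∑∞ a ≈ l = (λ n → ∑[ i < n ] a (toℕ i)) ⟶ l

  -- y = e^x

  IsExp : Carrier → Carrier → Set
  IsExp x y = ∑∞ (λ i → x ^ i * fromℕ (i !) ⁻¹) ≈ y

------------------------------------------------------------------------
-- Randomized algorithms, differential privacy and additive error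

module Randomized (ℝ : CompleteOrderedField) where

  open CompleteOrderedField ℝ public

  -- Pr is a function on all predicates, but it is only constrained on events.

  record ProbabilitySpace : Set₂ where
    field
      Ω       : Set
      Event   : Pred Ω 0ℓ → Set₁
      event-≐ : ∀ {A B} → A ≐ B → Event A → Event B
      event-U : Event U
      event-∁ : ∀ {A} → Event A → Event (∁ A)
      event-⋃ : ∀ {A : ℕ → Pred Ω 0ℓ} → (∀ n → Event (A n)) → Event (⋃ ℕ A)

      Pr      : Pred Ω 0ℓ → Carrier
      Pr-cong : ∀ {A B} → Event A → A ≐ B → Pr A ≈ Pr B
      Pr-U    : Pr U ≈ 1#
      0≤Pr    : ∀ {A} → Event A → 0# ≤ Pr A
      Pr-⋃    : ∀ {A : ℕ → Pred Ω 0ℓ} → (∀ n → Event (A n)) →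
                (∀ m n → m ≢ n → A m ⊥ A n) →
                ∑∞ (λ n → Pr (A n)) ≈ Pr (⋃ ℕ A)

  -- The σ-algebra on ℝᵀ generated by the half-spaces {x | xₜ ≤ a}.

  data Borel {T : ℕ} : Pred (Vec Carrier T) 0ℓ → Set₁ where
    half-space : ∀ t a → Borel (λ x → lookup x t ≤ a)
    ext        : ∀ {A B} → A ≐ B → Borel A → Borel B
    compl      : ∀ {A} → Borel A → Borel (∁ A)
    union      : ∀ {A : ℕ → Pred (Vec Carrier T) 0ℓ} → (∀ n → Borel (A n)) → Borel (⋃ ℕ A)

  -- An online algorithm with random coins ω : Ω.  Its output at a time step
  -- is a random variable depending only on what has been received so far.

  record Algorithm (W : ℕ) : Set₂ where
    field
      space : ProbabilitySpace

    open ProbabilitySpace space public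

    field
      output            : History W → Ω → Carrier
      output-measurable : ∀ h a → Event (λ ω → output h ω ≤ a)

    outputs : ∀ {T} → IncrementalSequence W T → Ω → Vec Carrier T
    outputs s ω = tabulate (λ t → output (prefix s t) ω)

    Pr[outputs_∈_] : ∀ {T} → IncrementalSequence W T → Pred (Vec Carrier T) 0ℓ → Carrier
    Pr[outputs s ∈ S ] = Pr (λ ω → S (outputs s ω))

  EdgeDP : ∀ {W} → (T : ℕ) → Carrier → Algorithm W → Set₁
  EdgeDP {W} T ε A =
    ∃[ e^ε ] IsExp ε e^ε ×
      (∀ (s s' : IncrementalSequence W T) → EdgeAdjacent s s' →
       ∀ S → Borel S → Pr[outputs s ∈ S ] ≤ e^ε * Pr[outputs s' ∈ S ])
    where open Algorithm A

  -- The additive error of the outputs x is at most α at every time step.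

  Accurate : ∀ {W T} → IncrementalSequence W T → Carrier → Pred (Vec Carrier T) 0ℓ
  Accurate s α x = ∀ t → ∃[ w ] IsMSFWeight (graphAt s t) w × ∣ lookup x t - fromℕ w ∣ ≤ α

  -- On each input of length T, with probability at least γ.

  HasAdditiveError : ∀ {W} → (T : ℕ) → Carrier → Carrier → Algorithm W → Set
  HasAdditiveError {W} T γ α A =
    ∀ (s : IncrementalSequence W T) → γ ≤ Pr[outputs s ∈ Accurate s α ]
    where open Algorithm A

{-# OPTIONS --safe #-}

-- A packing argument.  On 2k isolated vertices, let the j-th input insert at
-- time j a perfect matching of k edges of weight W.  Its MSF weight jumps from
-- 0 to kW at time j, so an error below kW/2 lets the output determine j.  Each
-- of these T inputs is k edge insertions away from the sequence that inserts
-- nothing, so with e^ε ≤ c the output on that one sequence meets each of T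
-- disjoint events with probability at least γ c⁻ᵏ.  Hence T ≤ cᵏ / γ, which
-- fails when k is a small multiple of log T.

module Submission where

open import Defs
open import Level using (0ℓ)
open import Algebra.Bundles using (CommutativeRing)
import Algebra.Properties.AbelianGroup as AbelianGroupProperties
import Algebra.Properties.Monoid.Mult as MonoidMult
import Algebra.Properties.Monoid.Sum as MonoidSum
import Algebra.Properties.Ring as RingProperties
import Algebra.Properties.Semiring.Mult as SemiringMult
import Algebra.Properties.Semiring.Sum as SemiringSum
open import Axiom.DoubleNegationElimination using (em⇒dne)
open import Axiom.ExcludedMiddle using (ExcludedMiddle)
open import Data.Fin as Fin using (Fin; zero; suc; toℕ; fromℕ<)
import Data.Fin.Properties as Finₚ
open import Data.List using (List; []; _∷_; _++_; applyDownFrom; upTo; take; foldl)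
open import Data.List.Membership.Propositional using (_∈_; _∉_)
open import Data.List.Membership.Propositional.Properties using (∈-applyDownFrom⁻; ∈-upTo⁺)
open import Data.List.Membership.Propositional.Properties.WithK using (unique∧set⇒bag)
open import Data.List.Properties using (++-identityʳ)
open import Data.List.Relation.Binary.BagAndSetEquality using (_∼[_]_; set; ∼bag⇒↭)
import Data.List.Relation.Binary.Permutation.Propositional.Properties as ↭ₚ
open import Data.List.Relation.Binary.Subset.Propositional using (_⊆_)
open import Data.List.Relation.Unary.All using ([]; _∷_)
import Data.List.Relation.Unary.All.Properties as Allₚ
open import Data.List.Relation.Unary.AllPairs using (AllPairs; []; _∷_)
import Data.List.Relation.Unary.AllPairs.Properties as AllPairsₚ
open import Data.List.Relation.Unary.Any using (here; there)
open import Data.List.Relation.Unary.Linked using ([]; _∷_)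
open import Data.List.Relation.Unary.Unique.Propositional using (Unique)
import Data.List.Relation.Unary.Unique.Propositional.Properties as Uniqueₚ
open import Data.Nat as ℕ using (ℕ; zero; suc; z≤n; s≤s; ⌊_/2⌋)
import Data.Nat.DivMod as ℕ/
open import Data.Nat.ListAction.Properties using (sum-↭)
open import Data.Nat.Logarithm using (⌈log₂_⌉; ⌈log₂⌉-mono-≤; ⌈log₂2^n⌉≡n)
import Data.Nat.Properties as ℕₚ
open import Data.Product using (∃-syntax; _×_; _,_; proj₁; proj₂)
open import Data.Product.Properties using (,-injectiveˡ; ,-injectiveʳ)
open import Data.Sum using (_⊎_; inj₁; inj₂)
open import Data.Unit using (tt)
open import Data.Vec using (Vec; lookup; tabulate; toList; replicate; []; _∷_)
import Data.Vec.Properties as Vecₚ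
open import Function using (_∘_)
open import Function.Bundles using (_⇔_; mk⇔)
open import Relation.Binary.Construct.Closure.ReflexiveTransitive using (_◅_) renaming (ε to ε★)
open import Relation.Binary.Definitions using (tri<; tri≈; tri>)
open import Relation.Binary.PropositionalEquality as ≡ using (_≡_; _≢_)
import Relation.Binary.Reasoning.Base.Triple as Triple
open import Relation.Binary.Structures using (IsPreorder; IsStrictTotalOrder)
open import Relation.Nullary using (¬_; yes; no; contradiction; recompute)
open import Relation.Unary using (Pred; U; ∁; ⋃; _≐_; _⊥_; _∩_)

-- The constants come from `T ≤ q c^k`, where the natural number `c` bounds every value of e^ε and
-- `q γ > 1`. Since `n ≤ 2^n`, taking logarithms gives `⌈log₂ T⌉ ≤ q + c k`. With `L = ⌈log₂ T⌉`,
-- `m = q + c + 1` and `k = ⌊L / m⌋` this fails as soon as `k ≥ 1`, which `T ≥ 2^m` ensures.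
-- Rounding down costs at most a factor 2, so `L ≤ 2 m k`, and `k W ≤ 2 α` becomes `W L ≤ 4 m α`. A
-- matching is convenient because its only spanning forest is the matching itself, so its weight is
-- known without any minimisation. The obstacle is measurability: probabilities are constrained on
-- events only and privacy is promised for Borel sets only, whereas accuracy is phrased through an
-- existential over weights. Accuracy is therefore traded for closeness to an explicit weight
-- function, which is a finite intersection of closed half-spaces.

-- Logarithms and integer division

n≤2^n : ∀ n → n ℕ.≤ 2 ℕ.^ n
n≤2^n zero    = z≤n
n≤2^n (suc n) = ℕₚ.+-mono-≤ (ℕₚ.m^n>0 2 n) (ℕₚ.≤-trans (n≤2^n n) (ℕₚ.m≤m+n _ 0))

-- Bounding `q` by `2^q` and `c` by `2^c` is crude but keeps the exponent linear in `k`, so that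
-- only constants are lost.
log-bound : ∀ {n} q c k → n ℕ.≤ q ℕ.* c ℕ.^ k → ⌈log₂ n ⌉ ℕ.≤ q ℕ.+ c ℕ.* k
log-bound {n} q c k n≤ = begin
  ⌈log₂ n ⌉                      ≤⟨ ⌈log₂⌉-mono-≤ n≤2^ ⟩
  ⌈log₂ 2 ℕ.^ (q ℕ.+ c ℕ.* k) ⌉  ≡⟨ ⌈log₂2^n⌉≡n (q ℕ.+ c ℕ.* k) ⟩
  q ℕ.+ c ℕ.* k                  ∎
  where
  open ℕₚ.≤-Reasoning
  n≤2^ : n ℕ.≤ 2 ℕ.^ (q ℕ.+ c ℕ.* k)
  n≤2^ = begin
    n                                 ≤⟨ n≤ ⟩
    q ℕ.* c ℕ.^ k                     ≤⟨ ℕₚ.*-mono-≤ (n≤2^n q) (ℕₚ.^-monoˡ-≤ k (n≤2^n c)) ⟩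
    2 ℕ.^ q ℕ.* (2 ℕ.^ c) ℕ.^ k       ≡⟨ ≡.cong (2 ℕ.^ q ℕ.*_) (ℕₚ.^-*-assoc 2 c k) ⟩
    2 ℕ.^ q ℕ.* 2 ℕ.^ (c ℕ.* k)       ≡⟨ ℕₚ.^-distribˡ-+-* 2 q (c ℕ.* k) ⟨
    2 ℕ.^ (q ℕ.+ c ℕ.* k)             ∎

-- The remainder is below `m`, hence at most `m` times the quotient, which is at least 1 because
-- `m ≤ n`.
≤2m*[n/m] : ∀ m n .{{_ : ℕ.NonZero m}} → m ℕ.≤ n → n ℕ.≤ (m ℕ.+ m) ℕ.* (n ℕ/./ m)
≤2m*[n/m] m n m≤n = begin
  n                                   ≡⟨ ℕ/.m≡m%n+[m/n]*n n m ⟩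
  n ℕ/.% m ℕ.+ n ℕ/./ m ℕ.* m         ≤⟨ ℕₚ.+-monoˡ-≤ _ (ℕₚ.<⇒≤ (ℕ/.m%n<n n m)) ⟩
  m ℕ.+ n ℕ/./ m ℕ.* m                ≡⟨ ≡.cong₂ ℕ._+_ (≡.sym (ℕₚ.*-identityʳ m)) (ℕₚ.*-comm (n ℕ/./ m) m) ⟩
  m ℕ.* 1 ℕ.+ m ℕ.* (n ℕ/./ m)        ≤⟨ ℕₚ.+-monoˡ-≤ _ (ℕₚ.*-monoʳ-≤ m (ℕ/.m≥n⇒m/n>0 m≤n)) ⟩
  m ℕ.* (n ℕ/./ m) ℕ.+ m ℕ.* (n ℕ/./ m)  ≡⟨ ℕₚ.*-distribʳ-+ (n ℕ/./ m) m m ⟨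
  (m ℕ.+ m) ℕ.* (n ℕ/./ m)            ∎
  where open ℕₚ.≤-Reasoning

-- As the quotient `k` is at least 1, `q` is at most `q k`; the extra 1 in the divisor supplies
-- another `k`, which makes the inequality strict.
q+ck<n : ∀ q c n → suc (q ℕ.+ c) ℕ.≤ n → q ℕ.+ c ℕ.* (n ℕ/./ suc (q ℕ.+ c)) ℕ.< n
q+ck<n q c n m≤n = begin-strict
  q ℕ.+ c ℕ.* k                     ≡⟨ ≡.cong (ℕ._+ c ℕ.* k) (ℕₚ.*-identityʳ q) ⟨
  q ℕ.* 1 ℕ.+ c ℕ.* k               ≤⟨ ℕₚ.+-monoˡ-≤ _ (ℕₚ.*-monoʳ-≤ q 1≤k) ⟩
  q ℕ.* k ℕ.+ c ℕ.* k               ≡⟨ ℕₚ.*-distribʳ-+ k q c ⟨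
  (q ℕ.+ c) ℕ.* k                   <⟨ ℕₚ.+-monoˡ-≤ _ 1≤k ⟩
  suc (q ℕ.+ c) ℕ.* k               ≡⟨ ℕₚ.*-comm (suc (q ℕ.+ c)) k ⟩
  k ℕ.* suc (q ℕ.+ c)               ≤⟨ ℕ/.m/n*n≤m n (suc (q ℕ.+ c)) ⟩
  n                                 ∎
  where
  open ℕₚ.≤-Reasoning
  k = n ℕ/./ suc (q ℕ.+ c)
  1≤k : 1 ℕ.≤ k
  1≤k = ℕ/.m≥n⇒m/n>0 m≤n

-- Spanning forests of matchings

module _ {W : ℕ} where

  open ≡

  _∈ends_ : ℕ → Edge W → Set
  v ∈ends e = v ≡ lo e ⊎ v ≡ hi e

  IsMatching : List (Edge W) → Set
  IsMatching E = ∀ {e f v} → e ∈ E → f ∈ E → v ∈ends e → v ∈ends f → e ≡ f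

  start-∈ends : ∀ {e : Edge W} {u v} → ends e ≡ (u , v) ⊎ ends e ≡ (v , u) → u ∈ends e
  start-∈ends (inj₁ refl) = inj₁ refl
  start-∈ends (inj₂ refl) = inj₂ refl

  other-end : ∀ {e : Edge W} {v u w} → ends e ≡ (v , u) ⊎ ends e ≡ (u , v) →
              ends e ≡ (v , w) ⊎ ends e ≡ (w , v) → u ≡ w
  other-end (inj₁ refl) (inj₁ refl) = refl
  other-end (inj₁ refl) (inj₂ q)    = trans (,-injectiveʳ q) (,-injectiveˡ q)
  other-end (inj₂ refl) (inj₁ q)    = trans (,-injectiveˡ q) (,-injectiveʳ q)
  other-end (inj₂ refl) (inj₂ refl) = refl

  adj-functional : ∀ {E} → IsMatching E → ∀ {v u w} → Adj E v u → Adj E v w → u ≡ w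
  adj-functional M {v} (e , e∈E , p) (f , f∈E , q)
    with refl ← M e∈E f∈E (start-∈ends {e} p) (start-∈ends {f} q) = other-end {e} p q

  adj-sym : ∀ {E : List (Edge W)} {u v} → Adj E u v → Adj E v u
  adj-sym (e , e∈E , inj₁ p) = e , e∈E , inj₂ p
  adj-sym (e , e∈E , inj₂ p) = e , e∈E , inj₁ p

  -- A cycle runs through at least three distinct vertices, so its second vertex would have two
  -- different neighbours.
  matching-acyclic : ∀ {E} → IsMatching E → Acyclic E
  matching-acyclic M u v w [] ((_ ∷ u≢w ∷ _) ∷ _) (uv ∷ vw ∷ _) = u≢w (adj-functional M (adj-sym uv) vw)
  matching-acyclic M u v w (_ ∷ _) ((_ ∷ u≢w ∷ _) ∷ _) (uv ∷ vw ∷ _) = u≢w (adj-functional M (adj-sym uv) vw)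

  first-step : ∀ {F : List (Edge W)} {u v} → u ≢ v → Connected F u v → ∃[ w ] Adj F u w
  first-step u≢v ε★        = contradiction refl u≢v
  first-step _   (uw ◅ _)  = _ , uw

  lo≢hi : (e : Edge W) → lo e ≢ hi e
  lo≢hi record { lo<hi = lo<hi } = ℕₚ.<⇒≢ (recompute (_ ℕ.<? _) lo<hi)

  -- The forest must connect the ends of `e`, so one of its edges meets `lo e`; that edge lies in
  -- the matching too and hence is `e`.
  spanning-forest-of-matching : ∀ {V E F} → IsMatching E → IsSpanningForest (graph V E) F → E ⊆ F
  spanning-forest-of-matching M (_ , F⊆E , _ , spans) {e} e∈E
    with first-step (lo≢hi e) (spans _ _ ((e , e∈E , inj₁ refl) ◅ ε★))
  ... | _ , f , f∈F , inj₁ refl with refl ← M e∈E (F⊆E f∈F) (inj₁ refl) (inj₁ refl) = f∈F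
  ... | _ , f , f∈F , inj₂ refl with refl ← M e∈E (F⊆E f∈F) (inj₁ refl) (inj₂ refl) = f∈F

  -- Every spanning forest has the same elements as `E`; both lists are free of repetitions, so they
  -- are permutations of each other and have equal weight.
  matching-MSFWeight : ∀ {V E} → Unique E → IsMatching E → IsMSFWeight (graph V E) (totalWeight E)
  matching-MSFWeight {V} {E} E! M =
      (E , (E! , (λ e∈E → e∈E) , matching-acyclic M , λ _ _ c → c) , refl)
    , λ F F-forest@(F! , F⊆E , _) → ℕₚ.≤-reflexive
        (sum-↭ (↭ₚ.map⁺ weight (∼bag⇒↭ (unique∧set⇒bag E! F! (mk⇔ (spanning-forest-of-matching {V} M F-forest) F⊆E)))))

  -- `Accurate` only provides some weight at each time; this identifies it with the computed one.
  MSFWeight-unique : ∀ {G : Graph W} {w w'} → IsMSFWeight G w → IsMSFWeight G w' → w ≡ w'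
  MSFWeight-unique ((F , Ff , refl) , min) ((F' , Ff' , refl) , min') = ℕₚ.≤-antisym (min F' Ff') (min' F Ff)

-- Matchings inserted in a single time step

module Burst {W : ℕ} (1≤W : 1 ℕ.≤ W) where

  open ≡

  edge : ℕ → Edge W
  edge i = record
    { lo = i ℕ.+ i ; hi = suc (i ℕ.+ i) ; weight = W
    ; lo<hi = ℕₚ.≤-refl ; 1≤weight = 1≤W ; weight≤W = ℕₚ.≤-refl }

  -- Counting down makes `edges (suc n)` reduce to `edge n ∷ edges n`, so that one more inserted
  -- edge is a cons.
  edges : ℕ → List (Edge W)
  edges = applyDownFrom edge

  -- Halving recovers the index of an edge from either end, which is why distinct edges share no
  -- vertex.
  halve-end : ∀ {i v} → v ∈ends edge i → ⌊ v /2⌋ ≡ i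
  halve-end {i} (inj₁ refl) = sym (ℕₚ.n≡⌊n+n/2⌋ i)
  halve-end {i} (inj₂ refl) = sym (ℕₚ.n≡⌈n+n/2⌉ i)

  edges-matching : ∀ n → IsMatching (edges n)
  edges-matching n e∈ f∈ v∈e v∈f with ∈-applyDownFrom⁻ edge e∈ | ∈-applyDownFrom⁻ edge f∈
  ... | i , _ , refl | j , _ , refl = cong edge (trans (sym (halve-end {i} v∈e)) (halve-end {j} v∈f))

  double-injective : ∀ i j → i ℕ.+ i ≡ j ℕ.+ j → i ≡ j
  double-injective i j p = trans (ℕₚ.n≡⌊n+n/2⌋ i) (trans (cong ⌊_/2⌋ p) (sym (ℕₚ.n≡⌊n+n/2⌋ j)))

  edges-simple : ∀ n → AllPairs (λ e f → ends e ≢ ends f) (edges n)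
  edges-simple n = AllPairsₚ.applyDownFrom⁺₁ edge n λ {i} {j} j<i _ p →
    ℕₚ.<⇒≢ j<i (sym (double-injective i j (,-injectiveˡ p)))

  edges-unique : ∀ n → Unique (edges n)
  edges-unique n = Uniqueₚ.applyDownFrom⁺₁ edge n λ {i} {j} j<i _ p →
    ℕₚ.<⇒≢ j<i (sym (double-injective i j (cong lo p)))

  totalWeight-edges : ∀ n → totalWeight (edges n) ≡ n ℕ.* W
  totalWeight-edges zero    = refl
  totalWeight-edges (suc n) = cong (W ℕ.+_) (totalWeight-edges n)

  MSFWeight-edges : ∀ {V} n → IsMSFWeight (graph V (edges n)) (n ℕ.* W)
  MSFWeight-edges {V} n = subst (IsMSFWeight (graph V (edges n))) (totalWeight-edges n)
    (matching-MSFWeight {V = V} (edges-unique n) (edges-matching n))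

  edges-insertion : ℕ → Insertion W
  edges-insertion i = record { ∂V = [] ; ∂E = edges i }

  -- The number `i` of inserted edges is a parameter: lowering it one by one at a fixed time `j`
  -- gives a chain of adjacent sequences from the full matching to no insertion.
  burst : ∀ {T} → ℕ → Fin T → Vec (Insertion W) T
  burst i zero    = edges-insertion i ∷ replicate _ (edges-insertion 0)
  burst i (suc j) = edges-insertion 0 ∷ burst i j

  -- The number of edges present at time t when i of them are inserted at time j.
  edgeCount : ∀ {T} → ℕ → Fin T → Fin T → ℕ
  edgeCount i zero    _       = i
  edgeCount i (suc j) zero    = 0
  edgeCount i (suc j) (suc t) = edgeCount i j t

  edgeCount-≤ : ∀ {T} i (j t : Fin T) → edgeCount i j t ℕ.≤ i
  edgeCount-≤ i zero    _       = ℕₚ.≤-refl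
  edgeCount-≤ i (suc j) zero    = z≤n
  edgeCount-≤ i (suc j) (suc t) = edgeCount-≤ i j t

  edgeCount-self : ∀ {T} i (j : Fin T) → edgeCount i j j ≡ i
  edgeCount-self i zero    = refl
  edgeCount-self i (suc j) = edgeCount-self i j

  edgeCount-before : ∀ {T} i {j t : Fin T} → t Fin.< j → edgeCount i j t ≡ 0
  edgeCount-before i {suc j} {zero}  _         = refl
  edgeCount-before i {suc j} {suc t} (s≤s t<j) = edgeCount-before i t<j

  -- Once no edge is left, the time `j` leaves no trace; hence all `T` chains end at the same
  -- insertions.
  burst-empty : ∀ {T} (j : Fin T) → burst 0 j ≡ replicate T (edges-insertion 0)
  burst-empty zero    = refl
  burst-empty (suc j) = cong (edges-insertion 0 ∷_) (burst-empty j)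

  insert-nothing : ∀ G → insert G (edges-insertion 0) ≡ G
  insert-nothing (graph V E) = cong₂ graph (++-identityʳ V) (++-identityʳ E)

  insert-nothing-repeatedly : ∀ {T} (t : Fin T) G →
    foldl insert G (take (suc (toℕ t)) (toList (replicate T (edges-insertion 0)))) ≡ G
  insert-nothing-repeatedly zero          G = insert-nothing G
  insert-nothing-repeatedly (suc zero)    G = trans (insert-nothing _) (insert-nothing G)
  insert-nothing-repeatedly (suc (suc t)) G =
    trans (insert-nothing-repeatedly (suc t) (insert G (edges-insertion 0))) (insert-nothing G)

  currentGraph-burst : ∀ {T} V E i (j t : Fin T) →
    currentGraph (historyAt (graph V E) (burst i j) t) ≡ graph V (E ++ edges (edgeCount i j t))
  currentGraph-burst V E i zero    zero    = cong (λ V' → graph V' (E ++ edges i)) (++-identityʳ V)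
  currentGraph-burst V E i zero    (suc t) =
    trans (insert-nothing-repeatedly t _) (cong (λ V' → graph V' (E ++ edges i)) (++-identityʳ V))
  currentGraph-burst V E i (suc j) zero    = cong (λ V' → graph V' (E ++ [])) (++-identityʳ V)
  currentGraph-burst V E i (suc j) (suc t) = trans
    (cong (λ G → foldl insert G (take (suc (toℕ t)) (toList (burst i j)))) (insert-nothing (graph V E)))
    (currentGraph-burst V E i j t)

  vertices : ℕ → List ℕ
  vertices k = upTo (k ℕ.+ k)

  edge-ends∈ : ∀ {i k} → i ℕ.< k → lo (edge i) ∈ vertices k × hi (edge i) ∈ vertices k
  edge-ends∈ {i} {k} i<k = ∈-upTo⁺ (ℕₚ.<-trans (ℕₚ.n<1+n _) hi<) , ∈-upTo⁺ hi<
    where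
    hi< : suc (i ℕ.+ i) ℕ.< k ℕ.+ k
    hi< = ℕₚ.≤-trans (ℕₚ.≤-reflexive (cong suc (sym (ℕₚ.+-suc i i)))) (ℕₚ.+-mono-≤ i<k i<k)

  edges-wellFormed : ∀ {n k} → n ℕ.≤ k → WellFormed (graph (vertices k) (edges n))
  edges-wellFormed {n} {k} n≤k =
      Uniqueₚ.upTo⁺ (k ℕ.+ k)
    , Allₚ.applyDownFrom⁺₁ edge n (λ i<n → edge-ends∈ (ℕₚ.<-≤-trans i<n n≤k))
    , edges-simple n

  -- The vertex set is sized by `k` and not by `i`, because adjacency demands a common initial graph
  -- along the chain. The bound is irrelevant, so the sequence does not depend on how `i ≤ k` is
  -- proved.
  burstSequence : ∀ {T i} (k : ℕ) → .(i ℕ.≤ k) → Fin T → IncrementalSequence W T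
  burstSequence {T} {i} k i≤k j = record
    { G₀ = graph (vertices k) []
    ; insertions = burst i j
    ; wellFormed₀ = edges-wellFormed (z≤n {k})
    ; wellFormed = λ t → subst WellFormed (sym (currentGraph-burst (vertices k) [] i j t))
        (edges-wellFormed (ℕₚ.≤-trans (edgeCount-≤ i j t) (recompute (i ℕ.≤? k) i≤k))) }

  burstSequence-MSFWeight : ∀ {T i k} .(i≤k : i ℕ.≤ k) (j t : Fin T) →
    IsMSFWeight (graphAt (burstSequence k i≤k j) t) (edgeCount i j t ℕ.* W)
  burstSequence-MSFWeight {i = i} {k} i≤k j t =
    subst (λ G → IsMSFWeight G _) (sym (currentGraph-burst (vertices k) [] i j t))
      (MSFWeight-edges {vertices k} (edgeCount i j t))

  lookup-burst-self : ∀ {T} i (j : Fin T) → lookup (burst i j) j ≡ edges-insertion i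
  lookup-burst-self i zero    = refl
  lookup-burst-self i (suc j) = lookup-burst-self i j

  lookup-burst-other : ∀ {T} i {j t : Fin T} → t ≢ j → lookup (burst i j) t ≡ edges-insertion 0
  lookup-burst-other i {zero}  {zero}  t≢j = contradiction refl t≢j
  lookup-burst-other i {zero}  {suc t} _   = Vecₚ.lookup-replicate t _
  lookup-burst-other i {suc j} {zero}  _   = refl
  lookup-burst-other i {suc j} {suc t} t≢j = lookup-burst-other i (t≢j ∘ cong suc)

  lookup-burst-∂V : ∀ {T} i (j t : Fin T) → ∂V (lookup (burst i j) t) ≡ []
  lookup-burst-∂V i j t with t Finₚ.≟ j
  ... | yes refl = cong ∂V (lookup-burst-self i j)
  ... | no  t≢j  = cong ∂V (lookup-burst-other i t≢j)

  edge∉edges : ∀ i → edge i ∉ edges i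
  edge∉edges i e∈ with ∈-applyDownFrom⁻ edge e∈
  ... | j , j<i , p = ℕₚ.<⇒≢ j<i (sym (double-injective i j (cong lo p)))

  ∼-reflexive : ∀ {A : Set} {xs ys : List A} → xs ≡ ys → xs ∼[ set ] ys
  ∼-reflexive refl = mk⇔ (λ p → p) (λ p → p)

  burst-adjacent : ∀ {T i k} .(i≤k : i ℕ.≤ k) .(i<k : i ℕ.< k) (j : Fin T) →
    OneEdgeLess (burstSequence k i<k j) (burstSequence k i≤k j)
  burst-adjacent {i = i} {k} i≤k i<k j =
      ∼-reflexive refl
    , ∼-reflexive refl
    , (λ t → ∼-reflexive (trans (lookup-burst-∂V (suc i) j t) (sym (lookup-burst-∂V i j t))))
    , edge i , j
    , (λ t t≢j → ∼-reflexive (cong ∂E (trans (lookup-burst-other (suc i) t≢j) (sym (lookup-burst-other i t≢j)))))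
    , at-j
    where
    at-j : ∂E (lookup (burst i j) j) ⊆ ∂E (lookup (burst (suc i) j) j)
         × (∀ e → (e ∈ ∂E (lookup (burst (suc i) j) j) × e ∉ ∂E (lookup (burst i j) j)) ⇔ e ≡ edge i)
    at-j rewrite lookup-burst-self i j | lookup-burst-self (suc i) j = there , λ e → mk⇔
      (λ { (here e≡ , _) → e≡ ; (there e∈ , e∉) → contradiction e∈ e∉ })
      (λ { refl → here refl , edge∉edges i })

-- Ordered field arithmetic and limits

module OrderedFieldProperties (ℝ : CompleteOrderedField) where

  open CompleteOrderedField ℝ
  open CommutativeRing commutativeRing public
    using ( refl; sym; trans; isEquivalence; ring; +-abelianGroup; +-congʳ
          ; +-comm; +-assoc; +-identityˡ; +-identityʳ; -‿inverseʳ; *-congˡ; *-congʳ; *-comm; *-assoc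
          ; *-identityˡ; *-identityʳ; zeroʳ; distribˡ; distribʳ)
  open AbelianGroupProperties +-abelianGroup public
    using ()
    renaming ( //-rightDividesˡ to x-y+y≈x; //-rightDividesʳ to x+y-y≈x
             ; ⁻¹-anti-homo‿- to -[x-y]≈y-x)
  open RingProperties ring public using ([y-z]x≈yx-zx; -‿involutive)
  open MonoidMult +-monoid public using (×-homo-+)
  open SemiringMult semiring public using (×1-homo-*)
  open IsStrictTotalOrder isStrictTotalOrder public
    using (compare; <-resp-≈; <-respˡ-≈; <-respʳ-≈)
    renaming (trans to <-trans; asym to <-asym; irrefl to <-irrefl)

  <⇒≤ : ∀ {x y} → x < y → x ≤ y
  <⇒≤ = <-asym

  ≤-reflexive : ∀ {x y} → x ≈ y → x ≤ y
  ≤-reflexive x≈y = <-irrefl (sym x≈y)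

  ≤-<-trans : ∀ {x y z} → x ≤ y → y < z → x < z
  ≤-<-trans {x} {y} x≤y y<z with compare x y
  ... | tri< x<y _ _ = <-trans x<y y<z
  ... | tri≈ _ x≈y _ = <-respˡ-≈ (sym x≈y) y<z
  ... | tri> _ _ y<x = contradiction y<x x≤y

  <-≤-trans : ∀ {x y z} → x < y → y ≤ z → x < z
  <-≤-trans {y = y} {z} x<y y≤z with compare y z
  ... | tri< y<z _ _ = <-trans x<y y<z
  ... | tri≈ _ y≈z _ = <-respʳ-≈ y≈z x<y
  ... | tri> _ _ z<y = contradiction z<y y≤z

  ≤-trans : ∀ {x y z} → x ≤ y → y ≤ z → x ≤ z
  ≤-trans x≤y y≤z z<x = x≤y (≤-<-trans y≤z z<x)

  ≤-isPreorder : IsPreorder _≈_ _≤_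
  ≤-isPreorder = record { isEquivalence = isEquivalence ; reflexive = ≤-reflexive ; trans = ≤-trans }

  open Triple ≤-isPreorder <-asym <-trans <-resp-≈ <⇒≤ <-≤-trans ≤-<-trans public

  +-cancelʳ-< : ∀ z {x y} → x + z < y + z → x < y
  +-cancelʳ-< z {x} {y} x+z<y+z = begin-strict
    x          ≈⟨ x+y-y≈x z x ⟨
    x + z - z  <⟨ +-monoˡ-< (- z) x+z<y+z ⟩
    y + z - z  ≈⟨ x+y-y≈x z y ⟩
    y          ∎

  +-monoˡ-≤ : ∀ z {x y} → x ≤ y → x + z ≤ y + z
  +-monoˡ-≤ z x≤y = x≤y ∘ +-cancelʳ-< z

  +-monoʳ-≤ : ∀ z {x y} → x ≤ y → z + x ≤ z + y
  +-monoʳ-≤ z {x} {y} x≤y = begin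
    z + x  ≈⟨ +-comm z x ⟩
    x + z  ≤⟨ +-monoˡ-≤ z x≤y ⟩
    y + z  ≈⟨ +-comm y z ⟩
    z + y  ∎

  +-mono-≤ : ∀ {x y u v} → x ≤ y → u ≤ v → x + u ≤ y + v
  +-mono-≤ x≤y u≤v = ≤-trans (+-monoˡ-≤ _ x≤y) (+-monoʳ-≤ _ u≤v)

  x≤x+y : ∀ {x y} → 0# ≤ y → x ≤ x + y
  x≤x+y {x} {y} 0≤y = begin
    x       ≈⟨ +-identityʳ x ⟨
    x + 0#  ≤⟨ +-monoʳ-≤ x 0≤y ⟩
    x + y   ∎

  x<y⇒0<y-x : ∀ {x y} → x < y → 0# < y - x
  x<y⇒0<y-x {x} {y} x<y = begin-strict
    0#     ≈⟨ -‿inverseʳ x ⟨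
    x - x  <⟨ +-monoˡ-< (- x) x<y ⟩
    y - x  ∎

  0<y-x⇒x<y : ∀ {x y} → 0# < y - x → x < y
  0<y-x⇒x<y {x} {y} 0<y-x = begin-strict
    x          ≈⟨ +-identityˡ x ⟨
    0# + x     <⟨ +-monoˡ-< x 0<y-x ⟩
    y - x + x  ≈⟨ x-y+y≈x x y ⟩
    y          ∎

  x-y<x : ∀ {x y} → 0# < y → x - y < x
  x-y<x {x} {y} 0<y = +-cancelʳ-< y (begin-strict
    x - y + y  ≈⟨ x-y+y≈x y x ⟩
    x          ≈⟨ +-identityˡ x ⟨
    0# + x     <⟨ +-monoˡ-< x 0<y ⟩
    y + x      ≈⟨ +-comm y x ⟩
    x + y      ∎)

  x-z≤y⇒x≤y+z : ∀ {x y z} → x - z ≤ y → x ≤ y + z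
  x-z≤y⇒x≤y+z {x} {y} {z} x-z≤y = begin
    x          ≈⟨ x-y+y≈x z x ⟨
    x - z + z  ≤⟨ +-monoˡ-≤ z x-z≤y ⟩
    y + z      ∎

  x≤y+z⇒x-z≤y : ∀ {x y z} → x ≤ y + z → x - z ≤ y
  x≤y+z⇒x-z≤y {x} {y} {z} x≤y+z = begin
    x - z      ≤⟨ +-monoˡ-≤ (- z) x≤y+z ⟩
    y + z - z  ≈⟨ x+y-y≈x z y ⟩
    y          ∎

  -‿cancel-< : ∀ {x y} → - x < - y → y < x
  -‿cancel-< {x} {y} -x<-y = 0<y-x⇒x<y (<-respʳ-≈
    (trans (+-comm _ _) (+-congʳ (-‿involutive x))) (x<y⇒0<y-x -x<-y))

  *-monoˡ-< : ∀ {z x y} → 0# < z → x < y → x * z < y * z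
  *-monoˡ-< {z} {x} {y} 0<z x<y =
    0<y-x⇒x<y (<-respʳ-≈ ([y-z]x≈yx-zx z y x) (*-pos (x<y⇒0<y-x x<y) 0<z))

  *-monoˡ-≤ : ∀ {z x y} → 0# ≤ z → x ≤ y → x * z ≤ y * z
  *-monoˡ-≤ {z} {x} {y} 0≤z x≤y with compare x y | compare 0# z
  ... | tri< x<y _ _ | tri< 0<z _ _ = <⇒≤ (*-monoˡ-< 0<z x<y)
  ... | tri≈ _ x≈y _ | _            = ≤-reflexive (*-congʳ x≈y)
  ... | tri> _ _ y<x | _            = contradiction y<x x≤y
  ... | _            | tri≈ _ 0≈z _ = ≤-reflexive
    (trans (*-congˡ (sym 0≈z)) (trans (zeroʳ x) (sym (trans (*-congˡ (sym 0≈z)) (zeroʳ y)))))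
  ... | _            | tri> _ _ z<0 = contradiction z<0 0≤z

  *-monoʳ-≤ : ∀ {z x y} → 0# ≤ z → x ≤ y → z * x ≤ z * y
  *-monoʳ-≤ {z} {x} {y} 0≤z x≤y = begin
    z * x  ≈⟨ *-comm z x ⟩
    x * z  ≤⟨ *-monoˡ-≤ 0≤z x≤y ⟩
    y * z  ≈⟨ *-comm y z ⟩
    z * y  ∎

  pos⇒≉0 : ∀ {x} → 0# < x → ¬ x ≈ 0#
  pos⇒≉0 0<x x≈0 = <-irrefl (sym x≈0) 0<x

  x*x⁻¹≈1 : ∀ {x} → 0# < x → x * x ⁻¹ ≈ 1#
  x*x⁻¹≈1 0<x = ⁻¹-inverseʳ _ (pos⇒≉0 0<x)

  0≤1 : 0# ≤ 1#
  0≤1 = <⇒≤ 0<1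

  ⁻¹-pos : ∀ {x} → 0# < x → 0# < x ⁻¹
  ⁻¹-pos {x} 0<x with compare 0# (x ⁻¹)
  ... | tri< 0<x⁻¹ _ _ = 0<x⁻¹
  ... | tri≈ _ 0≈x⁻¹ _ = contradiction 0<1 (≤-reflexive (begin-equality
    1#        ≈⟨ x*x⁻¹≈1 0<x ⟨
    x * x ⁻¹  ≈⟨ *-congˡ 0≈x⁻¹ ⟨
    x * 0#    ≈⟨ zeroʳ x ⟩
    0#        ∎))
  ... | tri> _ _ x⁻¹<0 = contradiction 0<1 (begin
    1#        ≈⟨ x*x⁻¹≈1 0<x ⟨
    x * x ⁻¹  ≤⟨ *-monoʳ-≤ (<⇒≤ 0<x) (<⇒≤ x⁻¹<0) ⟩
    x * 0#    ≈⟨ zeroʳ x ⟩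
    0#        ∎)

  *-cancelʳ-≤ : ∀ {z x y} → 0# < z → x * z ≤ y * z → x ≤ y
  *-cancelʳ-≤ 0<z xz≤yz y<x = xz≤yz (*-monoˡ-< 0<z y<x)

  ∣x∣≤y : ∀ {x y} → x ≤ y → - x ≤ y → ∣ x ∣ ≤ y
  ∣x∣≤y {x} x≤y -x≤y with x <? 0#
  ... | yes _ = -x≤y
  ... | no  _ = x≤y

  x≤∣x∣ : ∀ x → x ≤ ∣ x ∣
  x≤∣x∣ x with x <? 0#
  ... | no  _   = ≤-reflexive refl
  ... | yes x<0 = <⇒≤ (<-trans x<0 (<-respʳ-≈ (+-identityˡ (- x)) (x<y⇒0<y-x x<0)))

  -x≤∣x∣ : ∀ x → - x ≤ ∣ x ∣
  -x≤∣x∣ x with x <? 0#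
  ... | yes _   = ≤-reflexive refl
  ... | no  0≤x = ≤-trans -x≤0 0≤x
    where
    -x≤0 : - x ≤ 0#
    -x≤0 = begin
      - x        ≈⟨ +-identityˡ (- x) ⟨
      0# - x     ≤⟨ +-monoˡ-≤ (- x) 0≤x ⟩
      x - x      ≈⟨ -‿inverseʳ x ⟩
      0#         ∎

  y-x≤∣x-y∣ : ∀ x y → y - x ≤ ∣ x - y ∣
  y-x≤∣x-y∣ x y = ≤-trans (≤-reflexive (sym (-[x-y]≈y-x x y))) (-x≤∣x∣ (x - y))

  fromℕ-+ : ∀ m n → fromℕ (m ℕ.+ n) ≈ fromℕ m + fromℕ n
  fromℕ-+ = ×-homo-+ 1#

  fromℕ-* : ∀ m n → fromℕ (m ℕ.* n) ≈ fromℕ m * fromℕ n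
  fromℕ-* = ×1-homo-*

  0≤fromℕ : ∀ n → 0# ≤ fromℕ n
  0≤fromℕ zero    = ≤-reflexive refl
  0≤fromℕ (suc n) = ≤-trans 0≤1 (x≤x+y (0≤fromℕ n))

  0<fromℕ : ∀ n .{{_ : ℕ.NonZero n}} → 0# < fromℕ n
  0<fromℕ (suc n) = <-≤-trans 0<1 (x≤x+y (0≤fromℕ n))

  fromℕ-mono-≤ : ∀ {m n} → m ℕ.≤ n → fromℕ m ≤ fromℕ n
  fromℕ-mono-≤ {n = n} z≤n = 0≤fromℕ n
  fromℕ-mono-≤ (s≤s m≤n) = +-monoʳ-≤ 1# (fromℕ-mono-≤ m≤n)

  fromℕ-cancel-≤ : ∀ {m n} → fromℕ m ≤ fromℕ n → m ℕ.≤ n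
  fromℕ-cancel-≤ {m} {n} fm≤fn = ℕₚ.≮⇒≥ λ n<m → fm≤fn (begin-strict
    fromℕ n         ≈⟨ +-identityˡ (fromℕ n) ⟨
    0# + fromℕ n    <⟨ +-monoˡ-< (fromℕ n) 0<1 ⟩
    fromℕ (suc n)   ≤⟨ fromℕ-mono-≤ n<m ⟩
    fromℕ m         ∎)

  ∑-mono-≤ : ∀ n {f g : Fin n → Carrier} → (∀ i → f i ≤ g i) → ∑[ i < n ] f i ≤ ∑[ i < n ] g i
  ∑-mono-≤ zero    f≤g = ≤-reflexive refl
  ∑-mono-≤ (suc n) f≤g = +-mono-≤ (f≤g zero) (∑-mono-≤ n (f≤g ∘ suc))

  ∑-mono-≤-length : ∀ {a : ℕ → Carrier} → (∀ i → 0# ≤ a i) → ∀ {m n} → m ℕ.≤ n →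
                    ∑[ i < m ] a (toℕ i) ≤ ∑[ i < n ] a (toℕ i)
  ∑-mono-≤-length 0≤a {n = zero}  z≤n = ≤-reflexive refl
  ∑-mono-≤-length 0≤a {n = suc n} z≤n =
    ≤-trans (∑-mono-≤-length (0≤a ∘ suc) {n = n} z≤n) (≤-trans (x≤x+y (0≤a 0)) (≤-reflexive (+-comm _ _)))
  ∑-mono-≤-length {a} 0≤a (s≤s m≤n) = +-monoʳ-≤ (a 0) (∑-mono-≤-length (0≤a ∘ suc) m≤n)

  -- If one partial sum exceeded `l`, all later ones would exceed it by at least as much, since the
  -- terms are nonnegative; taking this excess as `δ` contradicts convergence.
  ∑≤∑∞ : ∀ {a : ℕ → Carrier} {l} → (∀ i → 0# ≤ a i) → ∑∞ a ≈ l → ∀ m → ∑[ i < m ] a (toℕ i) ≤ l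
  ∑≤∑∞ {a} {l} 0≤a a→l m l<s with a→l (s m - l) (x<y⇒0<y-x l<s)
    where
    s : ℕ → Carrier
    s n = ∑[ i < n ] a (toℕ i)
  ... | N , close = contradiction (close (m ℕ.⊔ N) (ℕₚ.m≤n⊔m m N))
    (≤-trans (+-monoˡ-≤ (- l) (∑-mono-≤-length 0≤a (ℕₚ.m≤m⊔n m N))) (x≤∣x∣ _))

  ∑∞≤bound : ∀ {a : ℕ → Carrier} {l b} → (∀ n → ∑[ i < n ] a (toℕ i) ≤ b) → ∑∞ a ≈ l → l ≤ b
  ∑∞≤bound {a} {l} {b} s≤b a→l b<l with a→l (l - b) (x<y⇒0<y-x b<l)
  ... | N , close = contradiction (≤-<-trans (y-x≤∣x-y∣ _ l) (close N ℕₚ.≤-refl))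
    (+-monoʳ-≤ l λ -s<-b → s≤b N (-‿cancel-< -s<-b))

  ^-pos : ∀ {x} → 0# < x → ∀ n → 0# < x ^ n
  ^-pos 0<x zero    = 0<1
  ^-pos 0<x (suc n) = *-pos 0<x (^-pos 0<x n)

  expTerm : Carrier → ℕ → Carrier
  expTerm x i = x ^ i * fromℕ (i ℕ.!) ⁻¹

  expTerm-nonNeg : ∀ {x} → 0# < x → ∀ i → 0# ≤ expTerm x i
  expTerm-nonNeg 0<x i = <⇒≤ (*-pos (^-pos 0<x i) (⁻¹-pos (0<fromℕ (i ℕ.!) {{i ℕₚ.!≢0}})))

  -- Consequences of completeness

  module Archimedean (em : ExcludedMiddle 0ℓ) where

    -- Otherwise the natural numbers have a least upper bound `b`; as `n + 1 ≤ b` for every `n`,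
    -- also `b - 1` is an upper bound, against leastness.
    archimedean : ∀ x → ∃[ n ] x < fromℕ n
    archimedean x with em {∃[ n ] x < fromℕ n}
    ... | yes p = p
    ... | no ¬p with complete (λ y → ∃[ n ] y ≈ fromℕ n) (0# , 0 , refl)
                       (x , λ { y (n , y≈n) x<y → ¬p (n , <-respʳ-≈ y≈n x<y) })
    ...   | b , b-upper , b-least = contradiction (x-y<x 0<1) (b-least (b - 1#) λ
              { y (n , y≈n) → ≤-trans (≤-reflexive (trans y≈n (sym (x+y-y≈x 1# (fromℕ n)))))
                  (+-monoˡ-≤ (- 1#) (b-upper _ (suc n , +-comm _ _))) })

    multiple-exceeds-1 : ∀ {x} → 0# < x → ∃[ n ] 1# < fromℕ n * x
    multiple-exceeds-1 {x} 0<x with archimedean (x ⁻¹)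
    ... | n , x⁻¹<n = n , (begin-strict
      1#           ≈⟨ trans (*-comm _ _) (x*x⁻¹≈1 0<x) ⟨
      x ⁻¹ * x     <⟨ *-monoˡ-< 0<x x⁻¹<n ⟩
      fromℕ n * x  ∎)

    -- Deciding whether e^x exists spares the proof that the exponential series converges.

    exp-bound : ∀ {x} → 0# < x → ∃[ n ] (∀ y → IsExp x y → y ≤ fromℕ n)
    exp-bound {x} 0<x with em {∃[ y ] IsExp x y}
    ... | no ¬exp = 0 , λ y exp → contradiction (y , exp) ¬exp
    ... | yes (y , y-exp) with archimedean y
    -- All terms are nonnegative, so `y` bounds the partial sums and thereby any other limit `z` of
    -- them.
    ...   | n , y<n = n , λ z z-exp → <⇒≤ (≤-<-trans
              (∑∞≤bound {expTerm x} (∑≤∑∞ (expTerm-nonNeg 0<x) y-exp) z-exp) y<n)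

    -- For `Borel-≥`: it exhibits the open half-line below `a` as a countable union of closed ones.
    reciprocal-gap : ∀ {x a} → x < a → ∃[ n ] x ≤ a - fromℕ (suc n) ⁻¹
    reciprocal-gap {x} {a} x<a with multiple-exceeds-1 (x<y⇒0<y-x x<a)
    ... | n , 1<n*d = n , (begin
      x                  ≈⟨ x+y-y≈x r x ⟨
      x + r - r          ≤⟨ +-monoˡ-≤ (- r) x+r≤a ⟩
      a - r              ∎)
      where
      N r d : Carrier
      N = fromℕ (suc n)
      r = N ⁻¹
      d = a - x
      0<N : 0# < N
      0<N = 0<fromℕ (suc n)
      r≤d : r ≤ d
      r≤d = *-cancelʳ-≤ 0<N (begin
        r * N        ≈⟨ trans (*-comm _ _) (x*x⁻¹≈1 0<N) ⟩
        1#           ≤⟨ <⇒≤ 1<n*d ⟩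
        fromℕ n * d  ≤⟨ *-monoˡ-≤ (<⇒≤ (x<y⇒0<y-x x<a)) (fromℕ-mono-≤ (ℕₚ.n≤1+n n)) ⟩
        N * d        ≈⟨ *-comm N d ⟩
        d * N        ∎)
      x+r≤a : x + r ≤ a
      x+r≤a = begin
        x + r  ≤⟨ +-monoʳ-≤ x r≤d ⟩
        x + d  ≈⟨ trans (+-comm x d) (x-y+y≈x x a) ⟩
        a      ∎

-- Probability and privacy

module Packing (em : ExcludedMiddle 0ℓ) (ℝ : CompleteOrderedField) where

  open Randomized ℝ
  open OrderedFieldProperties ℝ
  open Archimedean em
  open MonoidSum +-monoid using (sum-replicate)
  open SemiringSum semiring using (*-distribˡ-sum)
  open SemiringMult semiring using (×-assoc-*)
  open MonoidMult +-monoid using (×-congʳ)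

  module _ (space : ProbabilitySpace) where

    open ProbabilitySpace space

    event-∅ : Event (∁ U)
    event-∅ = event-∁ event-U

    -- Additivity is given for countable families only, so `U` is split into `A`, `∁ A` and
    -- infinitely many copies of the empty event; `Pr A` is the partial sum of length 1.
    Pr≤1 : ∀ {A} → Event A → Pr A ≤ 1#
    Pr≤1 {A} A-event = begin
      Pr A            ≈⟨ +-identityʳ (Pr A) ⟨
      Pr A + 0#       ≤⟨ ∑≤∑∞ {λ n → Pr (parts n)} (0≤Pr ∘ parts-event) (Pr-⋃ parts-event parts-disjoint) 1 ⟩
      Pr (⋃ ℕ parts)  ≈⟨ Pr-cong (event-⋃ parts-event) ((λ _ → tt) , cover) ⟩
      Pr U            ≈⟨ Pr-U ⟩
      1#              ∎
      where
      parts : ℕ → Pred Ω 0ℓ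
      parts 0             = A
      parts 1             = ∁ A
      parts (suc (suc _)) = ∁ U
      parts-event : ∀ n → Event (parts n)
      parts-event 0             = A-event
      parts-event 1             = event-∁ A-event
      parts-event (suc (suc _)) = event-∅
      parts-disjoint : ∀ m n → m ≢ n → parts m ⊥ parts n
      parts-disjoint 0             0             m≢n _         = m≢n ≡.refl
      parts-disjoint 0             1             _   (a , ¬a)  = ¬a a
      parts-disjoint 1             0             _   (¬a , a)  = ¬a a
      parts-disjoint 1             1             m≢n _         = m≢n ≡.refl
      parts-disjoint (suc (suc _)) _             _   (¬u , _)  = ¬u tt
      parts-disjoint 0             (suc (suc _)) _   (_ , ¬u)  = ¬u tt
      parts-disjoint 1             (suc (suc _)) _   (_ , ¬u)  = ¬u tt
      cover : ∀ {ω} → U ω → (⋃ ℕ parts) ω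
      cover {ω} _ with em {A ω}
      ... | yes a = 0 , a
      ... | no ¬a = 1 , ¬a

    ∑Pr≤1 : ∀ {n} {A : Fin n → Pred Ω 0ℓ} → (∀ i → Event (A i)) → (∀ i j → i ≢ j → A i ⊥ A j) →
            ∑[ i < n ] Pr (A i) ≤ 1#
    ∑Pr≤1 {n} {A} A-event A-disjoint = begin
      ∑[ i < n ] Pr (A i)                ≤⟨ ∑-mono-≤ n (λ i → ≤-reflexive (Pr-cong (A-event i) (at-toℕ i))) ⟩
      ∑[ i < n ] Pr (extended (toℕ i))   ≤⟨ ∑≤∑∞ {λ m → Pr (extended m)} (0≤Pr ∘ extended-event)
                                              (Pr-⋃ extended-event extended-disjoint) n ⟩
      Pr (⋃ ℕ extended)                  ≤⟨ Pr≤1 (event-⋃ extended-event) ⟩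
      1#                                 ∎
      where
      -- The finite family is continued by empty events: no index `i` satisfies `toℕ i ≡ m` when
      -- `m ≥ n`.
      extended : ℕ → Pred Ω 0ℓ
      extended m ω = ∃[ i ] toℕ i ≡ m × A i ω
      at-toℕ : ∀ i → A i ≐ extended (toℕ i)
      at-toℕ i = (λ a → i , ≡.refl , a) , λ { (j , p , a) → ≡.subst (λ i → A i _) (Finₚ.toℕ-injective p) a }
      extended-event : ∀ m → Event (extended m)
      extended-event m with m ℕ.<? n
      ... | yes m<n = ≡.subst (Event ∘ extended) (Finₚ.toℕ-fromℕ< m<n)
        (event-≐ (at-toℕ (fromℕ< m<n)) (A-event (fromℕ< m<n)))
      ... | no  m≮n = event-≐
        ((λ ¬u → contradiction tt ¬u) , λ { (i , ≡.refl , _) → contradiction (Finₚ.toℕ<n i) m≮n }) event-∅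
      extended-disjoint : ∀ l m → l ≢ m → extended l ⊥ extended m
      extended-disjoint l m l≢m ((i , ≡.refl , a) , (j , ≡.refl , b)) = A-disjoint i j (l≢m ∘ ≡.cong toℕ) (a , b)

  -- Borel sets of output sequences

  Borel-∩ : ∀ {T} {A B : Pred (Vec Carrier T) 0ℓ} → Borel A → Borel B → Borel (A ∩ B)
  Borel-∩ {T} {A} {B} A-borel B-borel = ext (to , from) (compl (union complements-borel))
    where
    complements : ℕ → Pred (Vec Carrier T) 0ℓ
    complements zero    = ∁ A
    complements (suc _) = ∁ B
    complements-borel : ∀ n → Borel (complements n)
    complements-borel zero    = compl A-borel
    complements-borel (suc _) = compl B-borel
    to : ∀ {x} → ∁ (⋃ ℕ complements) x → (A ∩ B) x
    to ¬∪ = em⇒dne em (λ ¬a → ¬∪ (0 , ¬a)) , em⇒dne em (λ ¬b → ¬∪ (1 , ¬b))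
    from : ∀ {x} → (A ∩ B) x → ∁ (⋃ ℕ complements) x
    from (a , b) (zero  , ¬a) = ¬a a
    from (a , b) (suc _ , ¬b) = ¬b b

  -- The induction starts from one set, not from the empty intersection: `Borel` has no constructor
  -- for the whole space, and for `T = 0` it contains no set at all.
  Borel-∀ : ∀ {T n} {A : Fin (suc n) → Pred (Vec Carrier T) 0ℓ} → (∀ i → Borel (A i)) → Borel (λ x → ∀ i → A i x)
  Borel-∀ {n = zero}  A-borel = ext ((λ { a zero → a }) , (λ a → a zero)) (A-borel zero)
  Borel-∀ {n = suc n} A-borel = ext
    ((λ { (a , as) zero → a ; (a , as) (suc i) → as i }) , (λ a → a zero , a ∘ suc))
    (Borel-∩ (A-borel zero) (Borel-∀ (A-borel ∘ suc)))

  Borel-≥ : ∀ {T} (t : Fin T) a → Borel (λ x → a ≤ lookup x t)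
  Borel-≥ t a = ext (to , from) (compl (union (λ n → half-space t (a - fromℕ (suc n) ⁻¹))))
    where
    to : ∀ {y} → ¬ (∃[ n ] y ≤ a - fromℕ (suc n) ⁻¹) → a ≤ y
    to ¬below x<a = ¬below (reciprocal-gap x<a)
    from : ∀ {y} → a ≤ y → ¬ (∃[ n ] y ≤ a - fromℕ (suc n) ⁻¹)
    from a≤x (n , x≤a-r) = a≤x (≤-<-trans x≤a-r (x-y<x (⁻¹-pos (0<fromℕ (suc n)))))

  -- Stands in for `Accurate`: with the weights given as a function, each time contributes an
  -- interval condition, which is visibly Borel.
  Close : ∀ {T} → (Fin T → ℕ) → Carrier → Pred (Vec Carrier T) 0ℓ
  Close w α x = ∀ t → ∣ lookup x t - fromℕ (w t) ∣ ≤ α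

  Close-borel : ∀ {T} (w : Fin (suc T) → ℕ) α → Borel (Close w α)
  Close-borel w α = Borel-∀ λ t → ext (to , from)
    (Borel-∩ (half-space t (α + fromℕ (w t))) (Borel-≥ t (fromℕ (w t) - α)))
    where
    to : ∀ {y a} → y ≤ α + a × a - α ≤ y → ∣ y - a ∣ ≤ α
    to {y} {a} (upper , lower) = ∣x∣≤y (x≤y+z⇒x-z≤y upper) (begin
      - (y - a)  ≈⟨ -[x-y]≈y-x y a ⟩
      a - y      ≤⟨ x≤y+z⇒x-z≤y (≤-trans (x-z≤y⇒x≤y+z lower) (≤-reflexive (+-comm y α))) ⟩
      α          ∎)
    from : ∀ {y a} → ∣ y - a ∣ ≤ α → y ≤ α + a × a - α ≤ y
    from {y} {a} close =
        x-z≤y⇒x≤y+z (≤-trans (x≤∣x∣ (y - a)) close)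
      , x≤y+z⇒x-z≤y (≤-trans (x-z≤y⇒x≤y+z (≤-trans (y-x≤∣x-y∣ y a) close)) (≤-reflexive (+-comm α y)))

  close-to-both : ∀ {x a b α} → ∣ x - a ∣ ≤ α → ∣ x - b ∣ ≤ α → b ≤ (α + α) + a
  close-to-both {x} {a} {b} {α} x~a x~b = begin
    b            ≤⟨ x-z≤y⇒x≤y+z (≤-trans (y-x≤∣x-y∣ x b) x~b) ⟩
    α + x        ≤⟨ +-monoʳ-≤ α (x-z≤y⇒x≤y+z (≤-trans (x≤∣x∣ _) x~a)) ⟩
    α + (α + a)  ≈⟨ +-assoc α α a ⟨
    (α + α) + a  ∎

  -- Packing for a fixed algorithm

  module _ {W : ℕ} (1≤W : 1 ℕ.≤ W) (A : Algorithm W) where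

    open Algorithm A
    open Burst 1≤W

    outputs-event : ∀ {T} (s : IncrementalSequence W T) {S} → Borel S → Event (λ ω → S (outputs s ω))
    outputs-event s (half-space t a) = event-≐
      ( (λ {ω} → ≡.subst (_≤ a) (≡.sym (Vecₚ.lookup∘tabulate (λ t → output (prefix s t) ω) t)))
      , (λ {ω} → ≡.subst (_≤ a) (Vecₚ.lookup∘tabulate (λ t → output (prefix s t) ω) t)) )
      (output-measurable (prefix s t) a)
    outputs-event s (ext (A⊆B , B⊆A) A-borel) = event-≐ (A⊆B , B⊆A) (outputs-event s A-borel)
    outputs-event s (compl A-borel) = event-∁ (outputs-event s A-borel)
    outputs-event s (union A-borel) = event-⋃ (λ n → outputs-event s (A-borel n))

    burstWeight : ∀ {T} → ℕ → Fin T → Fin T → ℕ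
    burstWeight k j t = edgeCount k j t ℕ.* W

    Accurate≐Close : ∀ {T} k (j : Fin T) α →
      Accurate (burstSequence k ℕₚ.≤-refl j) α ≐ Close (burstWeight k j) α
    Accurate≐Close k j α =
        (λ {x} → to {x})
      , λ close t → burstWeight k j t , burstSequence-MSFWeight ℕₚ.≤-refl j t , close t
      where
      to : ∀ {x} → Accurate (burstSequence k ℕₚ.≤-refl j) α x → Close (burstWeight k j) α x
      to accurate t with accurate t
      ... | w , w-weight , close
        with ≡.refl ← MSFWeight-unique {G = graphAt (burstSequence k ℕₚ.≤-refl j) t} w-weight
                        (burstSequence-MSFWeight {k = k} ℕₚ.≤-refl j t) = close

    -- At the earlier time `i` one target weight is already `k W` and the other still 0; an output
    -- within `α` of both would force `k W ≤ 2 α`.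
    Close-separated : ∀ {T k α} {i j : Fin T} → α + α < fromℕ (k ℕ.* W) → i Fin.< j →
                      Close (burstWeight k i) α ⊥ Close (burstWeight k j) α
    Close-separated {k = k} {α} {i} {j} 2α<kW i<j (close-i , close-j) = contradiction 2α<kW (begin
      fromℕ (k ℕ.* W)                      ≡⟨ ≡.cong (λ n → fromℕ (n ℕ.* W)) (edgeCount-self k i) ⟨
      fromℕ (burstWeight k i i)            ≤⟨ close-to-both (close-j i) (close-i i) ⟩
      (α + α) + fromℕ (burstWeight k j i)  ≡⟨ ≡.cong (λ n → (α + α) + fromℕ (n ℕ.* W)) (edgeCount-before k i<j) ⟩
      (α + α) + 0#                         ≈⟨ +-identityʳ _ ⟩
      α + α                                ∎)

    Close-disjoint : ∀ {T k α} → α + α < fromℕ (k ℕ.* W) →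
                     ∀ (i j : Fin T) → i ≢ j → Close (burstWeight k i) α ⊥ Close (burstWeight k j) α
    Close-disjoint {k = k} 2α<kW i j i≢j {x} (close-i , close-j) with Finₚ.<-cmp i j
    ... | tri< i<j _ _ = Close-separated {k = k} 2α<kW i<j {x} (close-i , close-j)
    ... | tri≈ _ i≡j _ = i≢j i≡j
    ... | tri> _ _ j<i = Close-separated {k = k} 2α<kW j<i {x} (close-j , close-i)

    -- Only outputs are compared: they depend on the initial graph and the insertions, while the
    -- sequences also carry proofs of well-formedness.
    outputs-empty-burst : ∀ {T k} (i j : Fin T) ω →
      outputs (burstSequence k z≤n i) ω ≡ outputs (burstSequence k z≤n j) ω
    outputs-empty-burst {k = k} i j ω = ≡.cong (λ us → tabulate (λ t → output (historyAt (graph (vertices k) []) us t) ω))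
      (≡.trans (burst-empty i) (≡.sym (burst-empty j)))

    -- A natural factor in place of e^ε lets the powers be taken in `ℕ`, where the final comparison
    -- with `T` happens.
    PrivateWithFactor : ℕ → ℕ → Set₁
    PrivateWithFactor T c = ∀ (s s' : IncrementalSequence W T) → EdgeAdjacent s s' →
                          ∀ S → Borel S → Pr[outputs s ∈ S ] ≤ fromℕ c * Pr[outputs s' ∈ S ]

    EdgeDP⇒PrivateWithFactor : ∀ {T ε} c → (∀ y → IsExp ε y → y ≤ fromℕ c) → EdgeDP T ε A → PrivateWithFactor T c
    EdgeDP⇒PrivateWithFactor c exp-ε≤c (e^ε , e^ε-exp , bounded) s s' adjacent S S-borel =
      ≤-trans (bounded s s' adjacent S S-borel) (*-monoˡ-≤ (0≤Pr (outputs-event s' S-borel)) (exp-ε≤c e^ε e^ε-exp))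

    module _ {T : ℕ} (c : ℕ) (private-A : PrivateWithFactor (suc T) c) where

      group-privacy : ∀ {i k} (i≤k : i ℕ.≤ k) (j : Fin (suc T)) {S} → Borel S →
        Pr[outputs burstSequence k i≤k j ∈ S ] ≤ fromℕ (c ℕ.^ i) * Pr[outputs burstSequence k z≤n j ∈ S ]
      -- By irrelevance of the bound both sides concern the same sequence; the factor is `c^0`,
      -- which unfolds to `1# + 0#`.
      group-privacy {zero}      i≤k j S-borel = ≤-reflexive (sym (trans (*-congʳ (+-identityʳ 1#)) (*-identityˡ _)))
      group-privacy {suc i} {k} i<k j {S} S-borel = begin
        Pr[outputs burstSequence k i<k j ∈ S ]
          ≤⟨ private-A (burstSequence k i<k j) (burstSequence k i≤k j) (inj₁ (burst-adjacent i≤k i<k j)) S S-borel ⟩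
        fromℕ c * Pr[outputs burstSequence k i≤k j ∈ S ]  ≤⟨ *-monoʳ-≤ (0≤fromℕ c) (group-privacy i≤k j S-borel) ⟩
        fromℕ c * (fromℕ (c ℕ.^ i) * p₀)                  ≈⟨ *-assoc _ _ _ ⟨
        fromℕ c * fromℕ (c ℕ.^ i) * p₀                    ≈⟨ *-congʳ (fromℕ-* c (c ℕ.^ i)) ⟨
        fromℕ (c ℕ.^ suc i) * p₀                          ∎
        where
        i≤k = ℕₚ.<⇒≤ i<k
        p₀ = Pr[outputs burstSequence k z≤n j ∈ S ]

      packing : ∀ {γ α} k → HasAdditiveError (suc T) γ α A → α + α < fromℕ (k ℕ.* W) →
                fromℕ (suc T) * γ ≤ fromℕ (c ℕ.^ k)
      packing {γ} {α} k accurate 2α<kW = begin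
        fromℕ (suc T) * γ                ≈⟨ trans (×-assoc-* (suc T) 1# γ) (×-congʳ (suc T) (*-identityˡ γ)) ⟩
        suc T · γ                        ≈⟨ sum-replicate (suc T) ⟨
        ∑[ j < suc T ] γ                 ≤⟨ ∑-mono-≤ (suc T) close-likely ⟩
        ∑[ j < suc T ] (b * p j)         ≈⟨ *-distribˡ-sum b p ⟨
        b * (∑[ j < suc T ] p j)         ≤⟨ *-monoʳ-≤ (0≤fromℕ (c ℕ.^ k)) (∑Pr≤1 space
                                              (λ j → outputs-event empty (close-borel j))
                                              (λ i j i≢j {ω} → Close-disjoint {k = k} 2α<kW i j i≢j {outputs empty ω})) ⟩
        b * 1#                           ≈⟨ *-identityʳ b ⟩
        b                                ∎
        where
        b : Carrier
        b = fromℕ (c ℕ.^ k)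
        empty : IncrementalSequence W (suc T)
        empty = burstSequence k z≤n zero
        close-borel : ∀ j → Borel (Close (burstWeight k j) α)
        close-borel j = Close-borel (burstWeight k j) α
        p : Fin (suc T) → Carrier
        p j = Pr[outputs empty ∈ Close (burstWeight k j) α ]
        close-likely : ∀ j → γ ≤ b * p j
        close-likely j = begin
          γ  ≤⟨ accurate s ⟩
          Pr[outputs s ∈ Accurate s α ]
            -- `Pr-cong` asks for an event, and measurability of the `Accurate` set is only
            -- available by transport from `Close`.
            ≈⟨ Pr-cong (event-≐ (proj₂ acc≐ , proj₁ acc≐) s-event) acc≐ ⟩
          Pr[outputs s ∈ Close (burstWeight k j) α ]
            ≤⟨ group-privacy {k} ℕₚ.≤-refl j (close-borel j) ⟩
          b * Pr[outputs burstSequence k z≤n j ∈ Close (burstWeight k j) α ]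
            -- Passage to the sequence `empty`, which is the same for all `j`, so that the disjoint
            -- events live on one output.
            ≈⟨ *-congˡ (Pr-cong (outputs-event (burstSequence k z≤n j) (close-borel j))
                 ( (λ {ω} → ≡.subst (Close (burstWeight k j) α) (outputs-empty-burst {k = k} j zero ω))
                 , (λ {ω} → ≡.subst (Close (burstWeight k j) α) (outputs-empty-burst {k = k} zero j ω)))) ⟩
          b * p j ∎
          where
          s = burstSequence k ℕₚ.≤-refl j
          s-event : Event (λ ω → Close (burstWeight k j) α (outputs s ω))
          s-event = outputs-event s (close-borel j)
          acc≐ : (λ ω → Accurate s α (outputs s ω)) ≐ (λ ω → Close (burstWeight k j) α (outputs s ω))
          acc≐ = (λ {ω} → proj₁ (Accurate≐Close k j α) {outputs s ω})
               , (λ {ω} → proj₂ (Accurate≐Close k j α) {outputs s ω})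

      -- Multiplying the packing bound by `q`, where `q γ > 1`, removes `γ` and leaves an inequality
      -- between natural numbers.
      log-length-bound : ∀ {γ α} q → 1# < fromℕ q * γ → ∀ k → HasAdditiveError (suc T) γ α A →
                         α + α < fromℕ (k ℕ.* W) → ⌈log₂ suc T ⌉ ℕ.≤ q ℕ.+ c ℕ.* k
      log-length-bound {γ} q 1<qγ k accurate 2α<kW = log-bound {suc T} q c k (fromℕ-cancel-≤ (begin
        fromℕ (suc T)                  ≈⟨ *-identityʳ _ ⟨
        fromℕ (suc T) * 1#             ≤⟨ *-monoʳ-≤ (0≤fromℕ (suc T)) (<⇒≤ 1<qγ) ⟩
        fromℕ (suc T) * (fromℕ q * γ)  ≈⟨ trans (*-congˡ (*-comm _ γ)) (trans (sym (*-assoc _ γ _)) (*-comm _ _)) ⟩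
        fromℕ q * (fromℕ (suc T) * γ)  ≤⟨ *-monoʳ-≤ (0≤fromℕ q) (packing k accurate 2α<kW) ⟩
        fromℕ q * fromℕ (c ℕ.^ k)      ≈⟨ fromℕ-* q (c ℕ.^ k) ⟨
        fromℕ (q ℕ.* c ℕ.^ k)          ∎))

  error-scaling : ∀ {α} M {k n W} → n ℕ.≤ M ℕ.* k → fromℕ (k ℕ.* W) ≤ α + α →
                  fromℕ (W ℕ.* n) ≤ fromℕ (M ℕ.+ M) * α
  error-scaling {α} M {k} {n} {W} n≤Mk kW≤2α = begin
    fromℕ (W ℕ.* n)              ≤⟨ fromℕ-mono-≤ W*n≤ ⟩
    fromℕ (M ℕ.* (k ℕ.* W))      ≈⟨ fromℕ-* M (k ℕ.* W) ⟩
    fromℕ M * fromℕ (k ℕ.* W)    ≤⟨ *-monoʳ-≤ (0≤fromℕ M) kW≤2α ⟩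
    fromℕ M * (α + α)            ≈⟨ distribˡ (fromℕ M) α α ⟩
    fromℕ M * α + fromℕ M * α    ≈⟨ distribʳ α (fromℕ M) (fromℕ M) ⟨
    (fromℕ M + fromℕ M) * α      ≈⟨ *-congʳ (fromℕ-+ M M) ⟨
    fromℕ (M ℕ.+ M) * α          ∎
    where
    W*n≤ : W ℕ.* n ℕ.≤ M ℕ.* (k ℕ.* W)
    W*n≤ = ℕₚ.≤-trans (ℕₚ.*-monoʳ-≤ W n≤Mk) (ℕₚ.≤-reflexive (≡.trans (ℕₚ.*-comm W (M ℕ.* k)) (ℕₚ.*-assoc M k W)))

theorem29 : ExcludedMiddle 0ℓ → (ℝ : CompleteOrderedField) →
    let open Randomized ℝ in
    ∀ ε → 0# < ε → ∀ γ → 0# < γ →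
    ∃[ c ] 0# < c × ∃[ T₀ ] (
    ∀ T → T₀ ℕ.≤ T → ∀ W → 1 ℕ.≤ W →
    ∀ (A : Algorithm W) → EdgeDP T ε A →
    ∀ α → HasAdditiveError T γ α A →
    c * fromℕ (W ℕ.* ⌈log₂ T ⌉) ≤ α)
theorem29 em ℝ ε 0<ε γ 0<γ with Archimedean.exp-bound em 0<ε | Archimedean.multiple-exceeds-1 em 0<γ
  where open OrderedFieldProperties ℝ
... | c , exp-ε≤c | q , 1<qγ = fromℕ (M ℕ.+ M) ⁻¹ , ⁻¹-pos 0<2M , 2 ℕ.^ m , lower-bound
  where
  open Randomized ℝ
  open OrderedFieldProperties ℝ
  open Packing em ℝ
  m M : ℕ
  m = suc (q ℕ.+ c)
  M = m ℕ.+ m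
  0<2M : 0# < fromℕ (M ℕ.+ M)
  0<2M = 0<fromℕ (M ℕ.+ M)
  lower-bound : ∀ T → 2 ℕ.^ m ℕ.≤ T → ∀ W → 1 ℕ.≤ W → ∀ (A : Algorithm W) → EdgeDP T ε A →
                ∀ α → HasAdditiveError T γ α A → fromℕ (M ℕ.+ M) ⁻¹ * fromℕ (W ℕ.* ⌈log₂ T ⌉) ≤ α
  lower-bound zero    2^m≤0 = contradiction (ℕₚ.m^n>0 2 m) (ℕₚ.≤⇒≯ 2^m≤0)
  lower-bound (suc T) 2^m≤T W 1≤W A private-A α accurate = *-cancelʳ-≤ 0<2M (begin
    fromℕ (M ℕ.+ M) ⁻¹ * X * fromℕ (M ℕ.+ M)  ≈⟨ trans (*-comm _ _) (sym (*-assoc _ _ X)) ⟩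
    fromℕ (M ℕ.+ M) * fromℕ (M ℕ.+ M) ⁻¹ * X  ≈⟨ trans (*-congʳ (x*x⁻¹≈1 0<2M)) (*-identityˡ X) ⟩
    X                                         ≤⟨ error-scaling M {k} {L} {W} (≤2m*[n/m] m L m≤L) kW≤2α ⟩
    fromℕ (M ℕ.+ M) * α                       ≈⟨ *-comm _ α ⟩
    α * fromℕ (M ℕ.+ M)                       ∎)
    where
    L k : ℕ
    L = ⌈log₂ suc T ⌉
    k = L ℕ/./ m
    X : Carrier
    X = fromℕ (W ℕ.* L)
    m≤L : m ℕ.≤ L
    m≤L = ℕₚ.≤-trans (ℕₚ.≤-reflexive (≡.sym (⌈log₂2^n⌉≡n m))) (⌈log₂⌉-mono-≤ 2^m≤T)
    kW≤2α : fromℕ (k ℕ.* W) ≤ α + α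
    -- As `≤` is the negation of the reversed `<`, one may assume `2 α < k W`; packing then gives
    -- `L ≤ q + c k`, which the choice of `k` excludes.
    kW≤2α 2α<kW = ℕₚ.<⇒≱ (q+ck<n q c L m≤L)
      (log-length-bound 1≤W A c (EdgeDP⇒PrivateWithFactor 1≤W A c exp-ε≤c private-A) q 1<qγ k accurate 2α<kW)
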